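{- Let $\mathcal{K}$ be the class of $\{\to\}$-subreducts of subresiduated lattices (viewed as algebras $(A,\to,1)$ of type $(2,0)$). Then every sub-Hilbert algebra belongs to $\mathcal{K}$.
   Context: A subresiduated lattice is an algebra $(A,\wedge,\vee,\to,0,1)$ of type $(2,2,2,0,0)$ such that $(A,\wedge,\vee,0,1)$ is a bounded distributive lattice and for all $x,y,z\in A$: $x\to x=1$; $x\to y\le z\to(x\to y)$; $x\wedge(x\to y)\le y$; $z\to(x\wedge y)=(z\to x)\wedge(z\to y)$; $(x\vee y)\to z=(x\to z)\wedge(y\to z)$; $(x\to y)\wedge(y\to z)\le x\to z$. A $\{\to\}$-subreduct of a subresiduated lattice $A$ is any isomorphic image of a (nonempty) subalgebra of the reduct $(A,\to)$. Since $1=x\to x$, such a subalgebra always contains $1$, so it is viewed as an algebra of type $(2,0)$ with operations $\to,1$. A sub-Hilbert algebra is an algebra $(A,\to,1)$ of type $(2,0)$ satisfying, for all $x,y,z\in A$: (B) $(x\to y)\to((y\to z)\to(x\to z))=1$; (I) $x\to x=1$; (T) $x\to 1=1$; (A) if $x\to y=1$ and $y\to x=1$ then $x=y$; (S) $(x\to(y\to z))\to((x\to y)\to(x\to z))=1$. -}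

module Defs where

open import Level using (Level; suc; _⊔_)
open import Algebra.Core using (Op₂)
open import Algebra.Definitions using (Congruent₂)
open import Algebra.Lattice.Structures using (IsDistributiveLattice)
open import Algebra.Morphism.Definitions using (Homomorphic₀; Homomorphic₂)
open import Data.Product using (Σ-syntax; ∃; ∃-syntax; _,_; proj₁)
open import Function.Base using (_on_)
open import Relation.Binary.Core using (Rel)
open import Relation.Binary.Definitions using (_Respects_)
open import Relation.Binary.Structures using (IsEquivalence)
open import Relation.Binary.Morphism.Structures using (IsRelIsomorphism)
import Relation.Binary.Construct.On as On
open import Relation.Unary using (Pred; _∈_)

private
  variable
    c ℓ c₁ ℓ₁ c₂ ℓ₂ : Level

-- As in the library's algebraic hierarchy, equality in an algebra is an
-- arbitrary equivalence relation _≈_ that the operations respect.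

record ArrowAlgebra c ℓ : Set (suc (c ⊔ ℓ)) where
  infixr 6 _⇒_
  infix  4 _≈_
  field
    Carrier       : Set c
    _≈_           : Rel Carrier ℓ
    _⇒_           : Op₂ Carrier
    1#            : Carrier
    isEquivalence : IsEquivalence _≈_
    ⇒-cong        : Congruent₂ _≈_ _⇒_

record IsIsomorphism (A : ArrowAlgebra c₁ ℓ₁) (B : ArrowAlgebra c₂ ℓ₂)
                     (f : ArrowAlgebra.Carrier A → ArrowAlgebra.Carrier B)
                     : Set (c₁ ⊔ ℓ₁ ⊔ c₂ ⊔ ℓ₂) where
  private
    module A = ArrowAlgebra A
    module B = ArrowAlgebra B
  field
    isRelIsomorphism : IsRelIsomorphism A._≈_ B._≈_ f
    ⇒-homo           : Homomorphic₂ A.Carrier B.Carrier B._≈_ f A._⇒_ B._⇒_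
    1-homo           : Homomorphic₀ A.Carrier B.Carrier B._≈_ f A.1# B.1#

_≅_ : ArrowAlgebra c₁ ℓ₁ → ArrowAlgebra c₂ ℓ₂ → Set (c₁ ⊔ ℓ₁ ⊔ c₂ ⊔ ℓ₂)
A ≅ B = ∃ (IsIsomorphism A B)

record IsSubHilbertAlgebra (H : ArrowAlgebra c ℓ) : Set (c ⊔ ℓ) where
  open ArrowAlgebra H
  field
    B : ∀ x y z → (x ⇒ y) ⇒ ((y ⇒ z) ⇒ (x ⇒ z)) ≈ 1#
    I : ∀ x → x ⇒ x ≈ 1#
    T : ∀ x → x ⇒ 1# ≈ 1#
    A : ∀ x y → x ⇒ y ≈ 1# → y ⇒ x ≈ 1# → x ≈ y
    S : ∀ x y z → (x ⇒ (y ⇒ z)) ⇒ ((x ⇒ y) ⇒ (x ⇒ z)) ≈ 1#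

record SubresiduatedLattice c ℓ : Set (suc (c ⊔ ℓ)) where
  infixr 8 _⇒_
  infixr 7 _∧_
  infixr 6 _∨_
  infix  4 _≈_ _≤_
  field
    Carrier : Set c
    _≈_     : Rel Carrier ℓ
    _∧_     : Op₂ Carrier
    _∨_     : Op₂ Carrier
    _⇒_     : Op₂ Carrier
    0#      : Carrier
    1#      : Carrier

  _≤_ : Rel Carrier ℓ
  x ≤ y = x ∧ y ≈ x

  field
    isDistributiveLattice : IsDistributiveLattice _≈_ _∨_ _∧_
    0-minimum : ∀ x → 0# ≤ x
    1-maximum : ∀ x → x ≤ 1#
    ⇒-cong    : Congruent₂ _≈_ _⇒_
    ⇒-refl    : ∀ x → x ⇒ x ≈ 1#
    ⇒-stable  : ∀ x y z → x ⇒ y ≤ z ⇒ (x ⇒ y)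
    ⇒-mp      : ∀ x y → x ∧ (x ⇒ y) ≤ y
    ⇒-∧       : ∀ x y z → z ⇒ (x ∧ y) ≈ (z ⇒ x) ∧ (z ⇒ y)
    ∨-⇒       : ∀ x y z → (x ∨ y) ⇒ z ≈ (x ⇒ z) ∧ (y ⇒ z)
    ⇒-trans   : ∀ x y z → (x ⇒ y) ∧ (y ⇒ z) ≤ x ⇒ z

  open IsDistributiveLattice isDistributiveLattice public
    using (isEquivalence)

record Subuniverse (L : SubresiduatedLattice c ℓ) p : Set (c ⊔ ℓ ⊔ suc p) where
  open SubresiduatedLattice L
  field
    Member   : Pred Carrier p
    resp     : Member Respects _≈_
    nonempty : ∃[ x ] x ∈ Member
    closed   : ∀ {x y} → x ∈ Member → y ∈ Member → x ⇒ y ∈ Member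

  1-closed : 1# ∈ Member
  1-closed = let x , x∈M = nonempty in resp (⇒-refl x) (closed x∈M x∈M)

subalgebra : {L : SubresiduatedLattice c ℓ} {p : Level} →
             Subuniverse L p → ArrowAlgebra (c ⊔ p) ℓ
subalgebra {L = L} M = record
  { Carrier       = Σ[ x ∈ Carrier ] x ∈ Member
  ; _≈_           = _≈_ on proj₁
  ; _⇒_           = λ (x , x∈M) (y , y∈M) → x ⇒ y , closed x∈M y∈M
  ; 1#            = 1# , 1-closed
  ; isEquivalence = On.isEquivalence proj₁ isEquivalence
  ; ⇒-cong        = λ x≈x′ y≈y′ → ⇒-cong x≈x′ y≈y′
  }
  where
  open SubresiduatedLattice L
  open Subuniverse M

-- The class of {→}-subreducts. Its parameters are the universe levels of the
-- ambient lattice (carrier in Set a, equality in Set b) and of the predicate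
-- carving out the subalgebra (in Set p).

𝒦 : ∀ a b p → Pred (ArrowAlgebra c ℓ) (c ⊔ ℓ ⊔ suc (a ⊔ b ⊔ p))
𝒦 a b p A = Σ[ L ∈ SubresiduatedLattice a b ] Σ[ M ∈ Subuniverse L p ] subalgebra M ≅ A

{-# OPTIONS --safe #-}

-- For any preorder ⊑ on a set W, the subsets of W form a subresiduated lattice
-- under strict implication: w lies in P ⇒ Q iff every v ⊒ w in P lies in Q.
-- Take as worlds the implicative filters of a sub-Hilbert algebra A, with w ⊑ v
-- iff a ⇒ b ∈ w and a ∈ v imply b ∈ v; sending a to the set of filters that
-- contain it embeds A. The key point is that, for a filter w, the set
-- {b ∣ a ⇒ b ∈ w} is again a filter (by S), contains a (by I) and lies above w
-- (by B). Disjunctions never interact with the image of A, so the filters need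
-- not be prime and no choice principle is required.
--
-- To stay within the prescribed universe levels, only the filters obtained from
-- {1} by finitely many such steps are used, and the lattice consists of formal
-- terms over A, compared by the sets they denote.

module Submission where

open import Defs
open import Level using (Level; _⊔_; Lift; lift; lower)
open import Algebra.Lattice.Morphism.Structures using (IsLatticeMonomorphism)
import Algebra.Lattice.Morphism.LatticeMonomorphism as LatticeMonomorphism
open import Data.List.Base using (List; []; _∷_)
open import Data.Product.Base using (_,_; proj₁; proj₂; ∃-syntax)
open import Data.Sum.Base using (inj₁; inj₂; [_,_]′)
open import Function.Base using (id; _∘_; _on_)
open import Relation.Binary.Core using (Rel)
open import Relation.Binary.Structures using (IsEquivalence)
open import Relation.Unary using (Pred; _∈_; _⊆_; _≐_; _∩_; _∪_; ∅)
open import Relation.Unary.Algebra using (∪-∩-isDistributiveLattice)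
open import Relation.Unary.Properties using (≐-refl; ≐-sym; ≐-trans)

module Embedding {c ℓ} (𝐀 : ArrowAlgebra c ℓ) (H : IsSubHilbertAlgebra 𝐀) where
  open ArrowAlgebra 𝐀 renaming (Carrier to X)
  open IsEquivalence isEquivalence renaming (refl to ≈-refl; sym to ≈-sym; trans to ≈-trans)
  open IsSubHilbertAlgebra H

  infix 4 _⊢_ _⊑_ _≋_

  -- Γ represents the filter {b ∣ Γ ⊢ b}, namely aₙ ⇒ … ⇒ a₁ ⇒ b ≈ 1#
  -- for Γ = a₁ ∷ … ∷ aₙ ∷ [].
  _⊢_ : List X → X → Set ℓ
  []      ⊢ b = b ≈ 1#
  (a ∷ Γ) ⊢ b = Γ ⊢ a ⇒ b

  ⊢-true : ∀ Γ {a} → a ≈ 1# → Γ ⊢ a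
  ⊢-true []      a≈1 = a≈1
  ⊢-true (b ∷ Γ) a≈1 = ⊢-true Γ (≈-trans (⇒-cong ≈-refl a≈1) (T b))

  ⊢-mp : ∀ Γ {a b} → Γ ⊢ a ⇒ b → Γ ⊢ a → Γ ⊢ b
  -- The hypotheses give `1# ⇒ b ≈ 1#`; with `T`, antisymmetry `A` applies.
  ⊢-mp []      {a} {b} a⇒b≈1 a≈1 =
    A b 1# (T b) (≈-trans (⇒-cong (≈-sym a≈1) ≈-refl) a⇒b≈1)
  ⊢-mp (d ∷ Γ) {a} {b} p q = ⊢-mp Γ (⊢-mp Γ (⊢-true Γ (S d a b)) p) q

  ⊢-trans : ∀ Γ {a b d} → Γ ⊢ a ⇒ b → Γ ⊢ b ⇒ d → Γ ⊢ a ⇒ d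
  ⊢-trans Γ {a} {b} {d} p q = ⊢-mp Γ (⊢-mp Γ (⊢-true Γ (B a b d)) p) q

  ⊢-resp : ∀ Γ {a b} → a ≈ b → Γ ⊢ a → Γ ⊢ b
  ⊢-resp Γ {a} a≈b = ⊢-mp Γ (⊢-true Γ (≈-trans (⇒-cong ≈-refl (≈-sym a≈b)) (I a)))

  -- The instance `B a b b`, in which `b ⇒ b` is `1#`.
  ⊢-stable : ∀ Γ {a b} → Γ ⊢ a ⇒ b → Γ ⊢ 1# ⇒ (a ⇒ b)
  ⊢-stable Γ {a} {b} =
    ⊢-mp Γ (⊢-true Γ (≈-trans (⇒-cong ≈-refl (⇒-cong (≈-sym (I b)) ≈-refl)) (B a b b)))

  _⊑_ : Rel (List X) (c ⊔ ℓ)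
  Γ ⊑ Δ = ∀ {a b} → Γ ⊢ a ⇒ b → Δ ⊢ a → Δ ⊢ b

  ⊑-refl : ∀ Γ → Γ ⊑ Γ
  ⊑-refl Γ = ⊢-mp Γ

  ⊑-trans : ∀ Γ Δ Θ → Γ ⊑ Δ → Δ ⊑ Θ → Γ ⊑ Θ
  -- As `Δ ⊢ 1#`, stability carries the implication `a ⇒ b` itself from `Γ` to `Δ`.
  ⊑-trans Γ Δ Θ Γ⊑Δ Δ⊑Θ p = Δ⊑Θ (Γ⊑Δ (⊢-stable Γ p) (⊢-true Δ ≈-refl))

  ⊑-∷ : ∀ a Γ → Γ ⊑ a ∷ Γ
  ⊑-∷ a Γ p q = ⊢-trans Γ q p

  infixr 8 _⊃_
  infixr 7 _∧_
  infixr 6 _∨_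

  data Term : Set c where
    var         : X → Term
    ⊥           : Term
    _∧_ _∨_ _⊃_ : Term → Term → Term

  ⟦_⟧ : Term → Pred (List X) (c ⊔ ℓ)
  ⟦ var a ⟧ Γ = Lift c (Γ ⊢ a)
  ⟦ ⊥ ⟧     Γ = Lift (c ⊔ ℓ) (Γ ∈ ∅)
  ⟦ s ∧ t ⟧   = ⟦ s ⟧ ∩ ⟦ t ⟧
  ⟦ s ∨ t ⟧   = ⟦ s ⟧ ∪ ⟦ t ⟧
  ⟦ s ⊃ t ⟧ Γ = ∀ Δ → Γ ⊑ Δ → Δ ∈ ⟦ s ⟧ → Δ ∈ ⟦ t ⟧

  _≋_ : Rel Term (c ⊔ ℓ)
  _≋_ = _≐_ on ⟦_⟧

  ⊆⇒≋ : ∀ {s t} → ⟦ s ⟧ ⊆ ⟦ t ⟧ → s ∧ t ≋ s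
  ⊆⇒≋ s⊆t = proj₁ , λ p → p , s⊆t p

  -- Pulls the distributive lattice laws of subsets back to terms.
  ⟦⟧-isLatticeMonomorphism : IsLatticeMonomorphism
    (record { _≈_ = _≋_ ; _∧_ = _∧_ ; _∨_ = _∨_ })
    (record { _≈_ = _≐_ ; _∧_ = _∩_ ; _∨_ = _∪_ })
    ⟦_⟧
  ⟦⟧-isLatticeMonomorphism = record
    { isLatticeHomomorphism = record
      { isRelHomomorphism = record { cong = id }
      ; ∧-homo            = λ _ _ → ≐-refl
      ; ∨-homo            = λ _ _ → ≐-refl
      }
    ; injective = id
    }

  ⊃-cong : ∀ {s s′ t t′} → s ≋ s′ → t ≋ t′ → (s ⊃ t) ≋ (s′ ⊃ t′)
  ⊃-cong (s⊆s′ , s′⊆s) (t⊆t′ , t′⊆t) =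
      (λ f Δ Γ⊑Δ → t⊆t′ ∘ f Δ Γ⊑Δ ∘ s′⊆s)
    , (λ f Δ Γ⊑Δ → t′⊆t ∘ f Δ Γ⊑Δ ∘ s⊆s′)

  termLattice : SubresiduatedLattice c (c ⊔ ℓ)
  termLattice = record
    { Carrier = Term
    ; _≈_     = _≋_
    ; _∧_     = _∧_
    ; _∨_     = _∨_
    ; _⇒_     = _⊃_
    ; 0#      = ⊥
    -- Every filter contains `1#`, so this denotes the set of all worlds.
    ; 1#      = var 1#
    ; isDistributiveLattice =
        LatticeMonomorphism.isDistributiveLattice ⟦⟧-isLatticeMonomorphism
          (∪-∩-isDistributiveLattice _ _)
    ; 0-minimum = λ t → ⊆⇒≋ {⊥} {t} λ ()
    ; 1-maximum = λ t → ⊆⇒≋ {t} {var 1#} λ {Γ} _ → lift (⊢-true Γ ≈-refl)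
    ; ⇒-cong    = λ {s} {s′} {t} {t′} → ⊃-cong {s} {s′} {t} {t′}
    ; ⇒-refl    = λ _ → (λ {Γ} _ → lift (⊢-true Γ ≈-refl)) , λ _ _ _ → id
    ; ⇒-stable  = λ s t u → ⊆⇒≋ {s ⊃ t} {u ⊃ (s ⊃ t)}
        λ {Γ} f Δ Γ⊑Δ _ Θ Δ⊑Θ → f Θ (⊑-trans Γ Δ Θ Γ⊑Δ Δ⊑Θ)
    ; ⇒-mp      = λ s t → ⊆⇒≋ {s ∧ (s ⊃ t)} {t} λ {Γ} (p , f) → f Γ (⊑-refl Γ) p
    ; ⇒-∧       = λ _ _ _ →
          (λ f → (λ Δ Γ⊑Δ → proj₁ ∘ f Δ Γ⊑Δ) , (λ Δ Γ⊑Δ → proj₂ ∘ f Δ Γ⊑Δ))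
        , (λ (f , g) Δ Γ⊑Δ p → f Δ Γ⊑Δ p , g Δ Γ⊑Δ p)
    ; ∨-⇒       = λ _ _ _ →
          (λ f → (λ Δ Γ⊑Δ → f Δ Γ⊑Δ ∘ inj₁) , (λ Δ Γ⊑Δ → f Δ Γ⊑Δ ∘ inj₂))
        , (λ (f , g) Δ Γ⊑Δ → [ f Δ Γ⊑Δ , g Δ Γ⊑Δ ]′)
    ; ⇒-trans   = λ s t u → ⊆⇒≋ {(s ⊃ t) ∧ (t ⊃ u)} {s ⊃ u}
        λ (f , g) Δ Γ⊑Δ → g Δ Γ⊑Δ ∘ f Δ Γ⊑Δ
    }

  var-cong : ∀ {a b} → a ≈ b → var a ≋ var b
  var-cong a≈b = (λ {Γ} (lift p) → lift (⊢-resp Γ a≈b p))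
               , (λ {Γ} (lift p) → lift (⊢-resp Γ (≈-sym a≈b) p))

  var-injective : ∀ {a b} → var a ≋ var b → a ≈ b
  var-injective {a} {b} (a⊆b , b⊆a) =
    -- The two sets are compared at the principal filters of `a` and `b`.
    A a b (lower (a⊆b {a ∷ []} (lift (I a)))) (lower (b⊆a {b ∷ []} (lift (I b))))

  var-homo : ∀ a b → (var a ⊃ var b) ≋ var (a ⇒ b)
  var-homo a b =
      -- `a ∷ Γ` is the least world above `Γ` containing `a`, so testing there suffices.
      (λ {Γ} f → lift (lower (f (a ∷ Γ) (⊑-∷ a Γ) (lift (⊢-true Γ (I a))))))
    , (λ (lift p) Δ Γ⊑Δ (lift q) → lift (Γ⊑Δ p q))

  ⊃-var : ∀ {s t a b} → s ≋ var a → t ≋ var b → (s ⊃ t) ≋ var (a ⇒ b)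
  ⊃-var {s} {t} {a} {b} s≋a t≋b =
    ≐-trans (⊃-cong {s} {var a} {t} {var b} s≋a t≋b) (var-homo a b)

  image : Subuniverse termLattice (c ⊔ ℓ)
  image = record
    { Member   = λ t → ∃[ a ] t ≋ var a
    ; resp     = λ s≋t (a , s≋a) → a , ≐-trans (≐-sym s≋t) s≋a
    ; nonempty = var 1# , 1# , ≐-refl
    ; closed   = λ {s} {t} (a , s≋a) (b , t≋b) → a ⇒ b , ⊃-var {s} {t} s≋a t≋b
    }

  image≅ : subalgebra image ≅ 𝐀
  image≅ = (λ (_ , a , _) → a) , record
    { isRelIsomorphism = record
      { isMonomorphism = record
        { isHomomorphism = record
          { cong = λ {(_ , _ , s≋a)} {(_ , _ , t≋b)} s≋t →
              var-injective (≐-trans (≐-sym s≋a) (≐-trans s≋t t≋b)) }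
        ; injective = λ {(_ , _ , s≋a)} {(_ , _ , t≋b)} a≈b →
            ≐-trans s≋a (≐-trans (var-cong a≈b) (≐-sym t≋b))
        }
      ; surjective = λ a → (var a , a , ≐-refl) , λ {(_ , _ , s≋b)} s≋a →
          var-injective (≐-trans (≐-sym s≋b) s≋a)
      }
    ; ⇒-homo = λ _ _ → ≈-refl
    -- The unit of `subalgebra image` arises as `var 1# ⊃ var 1#`, so its recorded preimage is
    -- `1# ⇒ 1#`.
    ; 1-homo = I 1#
    }

proposition3p24 : {c ℓ : Level} (A : ArrowAlgebra c ℓ) →
    IsSubHilbertAlgebra A → A ∈ 𝒦 c (c ⊔ ℓ) (c ⊔ ℓ)
proposition3p24 A H = termLattice , image , image≅
  where open Embedding A H
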